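{- The grid $G(4,5)$ can be fully contaminated from only three initially contaminated cells, i.e. there exists $S\subseteq V_{4,5}$ with $|S|=3$ and $C(S)=V_{4,5}$. Consequently, it is false that for all integers $n,m\ge 1$ $$\gamma_c(G(n,m)) = \begin{cases} \max\left\{\left\lfloor \frac m2\right\rfloor,\left\lfloor \frac n2\right\rfloor\right\}+1, & \text{if } m \text{ and } n \text{ have the same parity},\\[0.6em] \max\left\{\left\lceil \frac m2\right\rceil,\left\lceil \frac n2\right\rceil\right\}+1, & \text{otherwise},\end{cases}$$ since for $(n,m)=(4,5)$ this formula gives the value $4$.
   Context: For integers $n,m\ge 1$, the grid $G(n,m)$ has cell set $V_{n,m}=\{(i,j): 1\le i\le n,\ 1\le j\le m\}$ ($i$ = row, $j$ = column). Contamination rules: a cell $u=(i,j)\in V_{n,m}$ can be contaminated by two contaminated cells $v,w\in V_{n,m}$ if one of the following holds: (a) $v=(i-1,j-1)$, $w=(i+1,j+1)$; (b) $v=(i+1,j-1)$, $w=(i-1,j+1)$; (c) $v=(i-1,j)$, $w=(i+1,j)$; (d) $v=(i,j-1)$, $w=(i,j+1)$; (e) $v=(i,j-1)$, $w=(i-1,j)$; (f) $v=(i,j-1)$, $w=(i+1,j)$; (g) $v=(i+1,j)$, $w=(i,j+1)$; (h) $v=(i-1,j)$, $w=(i,j+1)$. For $S\subseteq V_{n,m}$, the final contaminated set $C(S)$ is the smallest subset of $V_{n,m}$ containing $S$ and closed under rules (a)--(h). $S$ is a contaminating set (it fully contaminates the grid) if $C(S)=V_{n,m}$. The power contamination number $\gamma_c(G(n,m))$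 is the minimum cardinality of a contaminating set. -}

module Defs where

open import Data.Bool.Base using (if_then_else_)
import Data.Bool.Properties as Bool
open import Data.Fin.Base using (Fin; toℕ; remQuot)
open import Data.Fin.Properties using (all?)
open import Data.Fin.Subset using (Subset; _∈_; _⊆_; ⊤; ∣_∣)
open import Data.Fin.Subset.Properties
  using (_∈?_; _⊆?_; anySubset?; ∈⊤; ⊆⊤; ⊆-antisym)
open import Data.Integer.Base using (ℤ; +_; 1ℤ; _+_; _-_)
import Data.Integer.Properties as ℤ
open import Data.Nat.Base
  using (ℕ; zero; suc; _*_; _≤_; z≤n; s≤s; _⊔_; ⌊_/2⌋; ⌈_/2⌉; parity)
import Data.Nat.Base as ℕ
import Data.Nat.Properties as ℕ
import Data.Parity.Properties as ℙ
open import Data.Product.Base using (_×_; _,_; ∃; ∃-syntax; proj₁; proj₂)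
open import Data.Product.Properties using (≡-dec)
open import Data.Sum.Base using (_⊎_)
open import Data.Vec.Base using (tabulate)
open import Data.Vec.Properties using (lookup∘tabulate; []=⇒lookup; lookup⇒[]=)
import Data.Vec.Properties as Vec
open import Level using (Level)
open import Relation.Binary.PropositionalEquality using (_≡_; refl; sym; trans)
open import Relation.Nullary using (Dec; does; yes; no; ¬_; contradiction)
open import Relation.Nullary.Decidable
  using (_×-dec_; _⊎-dec_; _→-dec_; ¬?; map′; dec-true; decidable-stable)
open import Relation.Unary using (Pred; Decidable)

private variable
  ℓ : Level

comprehension : ∀ {k} {P : Pred (Fin k) ℓ} → Decidable P → Subset k
comprehension P? = tabulate (λ x → does (P? x))

∈-comprehension⁺ : ∀ {k} {P : Pred (Fin k) ℓ} (P? : Decidable P) {x} →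
                   P x → x ∈ comprehension P?
∈-comprehension⁺ P? {x} px =
  lookup⇒[]= x _ (trans (lookup∘tabulate _ x) (dec-true (P? x) px))

∈-comprehension⁻ : ∀ {k} {P : Pred (Fin k) ℓ} (P? : Decidable P) {x} →
                   x ∈ comprehension P? → P x
∈-comprehension⁻ P? {x} x∈
  with P? x | trans (sym (lookup∘tabulate (λ y → does (P? y)) x)) ([]=⇒lookup x∈)
... | yes px | _  = px
... | no _   | ()

allSubset? : ∀ {k} {P : Pred (Subset k) ℓ} → Decidable P → Dec (∀ U → P U)
allSubset? P? with anySubset? (λ U → ¬? (P? U))
... | yes (U , ¬pU) = no (λ all → ¬pU (all U))
... | no ¬∃         = yes (λ U → decidable-stable (P? U) (λ ¬pU → ¬∃ (U , ¬pU)))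

IsMinimum : Pred ℕ ℓ → ℕ → Set ℓ
IsMinimum P k = P k × (∀ j → P j → k ≤ j)

minimum : {P : Pred ℕ ℓ} → Decidable P → ∃ P → ∃ (IsMinimum P)
minimum {P = P} P? (n , pn) = search P P? n pn
  where
  search : (P : Pred ℕ _) → Decidable P → ∀ n → P n → ∃ (IsMinimum P)
  search P P? zero    p = zero , p , λ _ _ → z≤n
  search P P? (suc n) p with P? zero
  ... | yes p₀ = zero , p₀ , λ _ _ → z≤n
  ... | no ¬p₀ with search (λ j → P (suc j)) (λ j → P? (suc j)) n p
  ...   | k , pk , least = suc k , pk , λ
    { zero    p₀ → contradiction p₀ ¬p₀
    ; (suc j) pj → s≤s (least j pj) }

module Grid (n m : ℕ) where

  -- Cells are numbered row by row, so that sets of cells are library subsets;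
  -- `coord` recovers the pair (row , column), with 1 ≤ row ≤ n and
  -- 1 ≤ column ≤ m.  The coordinates are integers so that the rules may
  -- mention positions lying off the grid, which no cell has.
  Cell : Set
  Cell = Fin (n * m)

  CellSet : Set
  CellSet = Subset (n * m)

  coord : Cell → ℤ × ℤ
  coord u with remQuot {n} m u
  ... | i , j = + suc (toℕ i) , + suc (toℕ j)

  V : CellSet
  V = ⊤

  infix 4 _at_
  _at_ : Cell → ℤ × ℤ → Set
  v at p = coord v ≡ p

  -- The disjuncts are rules (a)–(h), in order.
  Contaminates : (v w u : Cell) → Set
  Contaminates v w u = rules (coord u)
    where
    rules : ℤ × ℤ → Set
    rules (i , j) =
        (v at (i - 1ℤ , j - 1ℤ) × w at (i + 1ℤ , j + 1ℤ))
      ⊎ (v at (i + 1ℤ , j - 1ℤ) × w at (i - 1ℤ , j + 1ℤ))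
      ⊎ (v at (i - 1ℤ , j)      × w at (i + 1ℤ , j))
      ⊎ (v at (i , j - 1ℤ)      × w at (i , j + 1ℤ))
      ⊎ (v at (i , j - 1ℤ)      × w at (i - 1ℤ , j))
      ⊎ (v at (i , j - 1ℤ)      × w at (i + 1ℤ , j))
      ⊎ (v at (i + 1ℤ , j)      × w at (i , j + 1ℤ))
      ⊎ (v at (i - 1ℤ , j)      × w at (i , j + 1ℤ))

  Closed : CellSet → Set
  Closed U = ∀ v w u → v ∈ U → w ∈ U → Contaminates v w u → u ∈ U

  at? : ∀ v p → Dec (v at p)
  at? v p = ≡-dec ℤ._≟_ ℤ._≟_ (coord v) p

  contaminates? : ∀ v w u → Dec (Contaminates v w u)
  contaminates? v w u =
          (at? v _ ×-dec at? w _)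
    ⊎-dec (at? v _ ×-dec at? w _)
    ⊎-dec (at? v _ ×-dec at? w _)
    ⊎-dec (at? v _ ×-dec at? w _)
    ⊎-dec (at? v _ ×-dec at? w _)
    ⊎-dec (at? v _ ×-dec at? w _)
    ⊎-dec (at? v _ ×-dec at? w _)
    ⊎-dec (at? v _ ×-dec at? w _)

  closed? : Decidable Closed
  closed? U = all? λ v → all? λ w → all? λ u →
    (v ∈? U) →-dec ((w ∈? U) →-dec (contaminates? v w u →-dec (u ∈? U)))

  InAllClosed : CellSet → Cell → Set
  InAllClosed S u = ∀ U → S ⊆ U → Closed U → u ∈ U

  inAllClosed? : ∀ S → Decidable (InAllClosed S)
  inAllClosed? S u =
    allSubset? λ U → (S ⊆? U) →-dec (closed? U →-dec (u ∈? U))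

  -- The final contaminated set is the intersection of all closed sets
  -- containing S; the three lemmas below say that it is the smallest one.
  C : CellSet → CellSet
  C S = comprehension (inAllClosed? S)

  S⊆C : ∀ S → S ⊆ C S
  S⊆C S u∈S = ∈-comprehension⁺ (inAllClosed? S) (λ U S⊆U _ → S⊆U u∈S)

  C-closed : ∀ S → Closed (C S)
  C-closed S v w u v∈C w∈C r = ∈-comprehension⁺ (inAllClosed? S) λ U S⊆U cl →
    cl v w u (∈-comprehension⁻ (inAllClosed? S) v∈C U S⊆U cl)
             (∈-comprehension⁻ (inAllClosed? S) w∈C U S⊆U cl) r

  C-smallest : ∀ S U → S ⊆ U → Closed U → C S ⊆ U
  C-smallest S U S⊆U cl u∈C = ∈-comprehension⁻ (inAllClosed? S) u∈C U S⊆U cl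

  IsContaminating : CellSet → Set
  IsContaminating S = C S ≡ V

  ContaminatingOfSize : ℕ → Set
  ContaminatingOfSize k = ∃[ S ] ∣ S ∣ ≡ k × IsContaminating S

  contaminatingOfSize? : Decidable ContaminatingOfSize
  contaminatingOfSize? k = anySubset? λ S →
    (∣ S ∣ ℕ.≟ k) ×-dec Vec.≡-dec Bool._≟_ (C S) V

  minimalSize : ∃ (IsMinimum ContaminatingOfSize)
  minimalSize = minimum contaminatingOfSize?
    (∣ V ∣ , V , refl , ⊆-antisym ⊆⊤ (S⊆C V))

  γc : ℕ
  γc = proj₁ minimalSize

  γc-isMinimum : IsMinimum ContaminatingOfSize γc
  γc-isMinimum = proj₂ minimalSize

open Grid public using (C; V; γc)

claimedValue : ℕ → ℕ → ℕ
claimedValue n m =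
  if does (parity m ℙ.≟ parity n)
  then (⌊ m /2⌋ ⊔ ⌊ n /2⌋) ℕ.+ 1
  else (⌈ m /2⌉ ⊔ ⌈ n /2⌉) ℕ.+ 1

{-# OPTIONS --safe #-}

-- Cells (1,1), (3,3), (4,5) contaminate all of G(4,5), so γc(G(4,5)) ≤ 3 < 4.
-- C(S) is defined as an intersection over all 2²⁰ cell sets, so it is bounded
-- below instead: every round of simultaneous contamination stays inside C(S),
-- and seven rounds already fill the grid.

module Submission where

open import Defs
open import Data.Bool.Base using (true; false)
import Data.Bool.Properties as Bool
open import Data.Fin.Properties using (any?)
open import Data.Fin.Subset using (_⊆_; _∈_; ⊤; ∣_∣)
open import Data.Fin.Subset.Properties using (_∈?_; ⊆⊤; ⊆-antisym)
open import Data.Nat.Base using (ℕ; zero; suc; _≤_)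
open import Data.Nat.Properties using (_≤?_)
open import Data.Product.Base using (_×_; _,_; proj₂; ∃-syntax)
open import Data.Sum.Base using (_⊎_; inj₁; inj₂)
open import Data.Vec.Base using (_∷_; [])
import Data.Vec.Properties as Vec
open import Relation.Binary.PropositionalEquality using (_≡_; refl; subst)
open import Relation.Nullary using (¬_)
open import Relation.Nullary.Decidable
  using (_×-dec_; _⊎-dec_; from-yes; from-no)
open import Relation.Unary using (Decidable)

module _ (n m : ℕ) where
  open Grid n m hiding (C; V; γc)

  -- Testing `v ∈ U` before quantifying over `w` lets the decision procedure skip the inner search
  -- for every uncontaminated `v`.
  OneRound : CellSet → Cell → Set
  OneRound U u =
    u ∈ U ⊎ (∃[ v ] v ∈ U × ∃[ w ] w ∈ U × Contaminates v w u)

  oneRound? : ∀ U → Decidable (OneRound U)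
  oneRound? U u =
    (u ∈? U) ⊎-dec
    any? λ v → (v ∈? U) ×-dec any? λ w → (w ∈? U) ×-dec contaminates? v w u

  rounds : ℕ → CellSet → CellSet
  rounds zero    U = U
  rounds (suc k) U = comprehension (oneRound? (rounds k U))

  rounds⊆C : ∀ k S → rounds k S ⊆ C n m S
  rounds⊆C zero    S = S⊆C S
  rounds⊆C (suc k) S {u} u∈ with ∈-comprehension⁻ (oneRound? (rounds k S)) u∈
  ... | inj₁ u∈k = rounds⊆C k S u∈k
  ... | inj₂ (v , v∈k , w , w∈k , r) =
    C-closed S v w u (rounds⊆C k S v∈k) (rounds⊆C k S w∈k) r

  rounds-contaminating : ∀ k S → rounds k S ≡ V n m → C n m S ≡ V n m
  rounds-contaminating k S eq =
    ⊆-antisym ⊆⊤ (subst (_⊆ C n m S) eq (rounds⊆C k S))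

  γc≤ : ∀ k → ∃[ S ] ∣ S ∣ ≡ k × C n m S ≡ V n m → γc n m ≤ k
  γc≤ k = proj₂ γc-isMinimum k

-- Rule (a) turns (1,1), (3,3) into (2,2), from which the top-left 3 × 3 block fills; then (2,3),
-- (4,5) give (3,4), which opens the last two columns. Row 4 fills from right to left, so (4,1)
-- comes last, in round 7.
seeds : Grid.CellSet 4 5
seeds =
  true  ∷ false ∷ false ∷ false ∷ false ∷
  false ∷ false ∷ false ∷ false ∷ false ∷
  false ∷ false ∷ true  ∷ false ∷ false ∷
  false ∷ false ∷ false ∷ false ∷ true  ∷ []

-- refl would also do, but its cell-by-cell comparison evaluates more slowly.
seeds-fill : rounds 4 5 7 seeds ≡ V 4 5
seeds-fill = from-yes (Vec.≡-dec Bool._≟_ (rounds 4 5 7 seeds) ⊤)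

three-suffice : ∃[ S ] ∣ S ∣ ≡ 3 × C 4 5 S ≡ V 4 5
three-suffice = seeds , refl , rounds-contaminating 4 5 7 seeds seeds-fill

mainTheorem2 : (∃[ S ] ∣ S ∣ ≡ 3 × C 4 5 S ≡ V 4 5)
    × ¬ (∀ n m → 1 ≤ n → 1 ≤ m → γc n m ≡ claimedValue n m)
    × claimedValue 4 5 ≡ 4
mainTheorem2 = three-suffice , formula-fails , refl
  where
  formula-fails : ¬ (∀ n m → 1 ≤ n → 1 ≤ m → γc n m ≡ claimedValue n m)
  -- The parities differ, so `claimedValue 4 5` computes to `(3 ⊔ 2) + 1`; the bound on `γc 4 5`
  -- becomes `4 ≤ 3`.
  formula-fails formula = from-no (4 ≤? 3)
    (subst (_≤ 3) (formula 4 5 (from-yes (1 ≤? 4)) (from-yes (1 ≤? 5)))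
      (γc≤ 4 5 3 three-suffice))
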